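{- Let $n\geq 10$ be an integer with $n\equiv 1\pmod 3$. Let $\hat{L}$ be the $n\times n$ matrix $$\hat{L}=\frac{n-1}{3}I_n-\frac13\begin{bmatrix}0&\mathbf{e}'\\ \mathbf{e}&\mathbf{0}\end{bmatrix}+\begin{bmatrix}0&\mathbf{0}'\\ \mathbf{0}&P\end{bmatrix},$$ where $P$ is the $(n-1)\times(n-1)$ circulant matrix defined in the context. Then $\hat{L}$ is a Laplacian-like matrix.
   Context: A real square matrix $A$ is called Laplacian-like if $A\mathbf{e}=0$ and $\mathbf{e}'A=0$, where $\mathbf{e}$ is the all-ones column vector of the appropriate size. The prime denotes transpose and $I_n$ is the identity matrix. In the block matrices the blocks have sizes $1$ and $n-1$, and $\mathbf{e}$ there lies in $\mathbb{R}^{n-1}$. For a vector $\mathbf{c}=(c_1,\dots,c_m)'$, $\operatorname{Circ}(\mathbf{c}')$ is the $m\times m$ circulant matrix with first row $(c_1,\dots,c_m)$ and each subsequent row the cyclic right shift by one of the previous row. Definition of $P$ (for $n\equiv 1\pmod 3$, $n\ge 10$). Let $\mathbf{e_i}$ be the $i$-th standard basis vector of $\mathbb{R}^{n-1}$ and $\mathbf{c_k}=\mathbf{e_{k+1}}+\mathbf{e_{n-k}}\in\mathbb{R}^{n-1}$, for $1\le k\le \frac{n-2}{2}$ if $n$ is even and $1\le k\le\frac{n-3}{2}$ if $n$ is odd. If $n$ is even, $P=\frac{1}{3(n-1)}\operatorname{Circ}(\mathbf{z_1}')$ with $$\mathbf{z_1}=(2n-n^2)\mathbf{e_1}+\sum_{k=1}^{\frac{n-4}{6}}\left(\frac{3n-18k+8}{2}\mathbf{c_{3k-2}}-\frac{3n-18k+4}{2}\mathbf{c_{3k-1}}+\mathbf{c_{3k}}\right)+\mathbf{c_{\frac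 n2-1}}.$$ If $n$ is odd, $P=\frac{1}{3(n-1)}\operatorname{Circ}(\mathbf{z_2}')$ with $$\mathbf{z_2}=(2n-n^2)\mathbf{e_1}+\sum_{k=1}^{\frac{n-1}{6}}\left(\frac{3n-18k+8}{2}\mathbf{c_{3k-2}}-\frac{3n-18k+4}{2}\mathbf{c_{3k-1}}\right)+\sum_{k=1}^{\frac{n-7}{6}}\mathbf{c_{3k}}+\mathbf{e_{\frac{n+1}{2}}}.$$ -}

module Defs where

open import Data.Bool.Base using (if_then_else_)
open import Data.Fin.Base using (Fin; zero; suc; toℕ; fromℕ; inject₁)
import Data.Fin.Properties as Fin
open import Data.Integer.Base using (+_)
open import Data.Nat.Base as ℕ using (ℕ; zero; suc; _∸_; _≤_; s≤s)
open import Data.Nat.Divisibility using (_∣?_)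
open import Data.Nat.GeneralisedArithmetic using (fold)
import Data.Nat.Properties as ℕ
open import Data.Product.Base using (_×_)
open import Data.Rational.Base using (ℚ; 0ℚ; 1ℚ; ½; _+_; _*_; _-_; _/_)
open import Data.Rational.Properties using (+-0-commutativeMonoid)
open import Data.Vec.Functional using (Vector; zipWith; map; replicate)
open import Relation.Binary.PropositionalEquality.Core using (_≗_)
open import Relation.Nullary.Decidable.Core using (does)

open import Algebra.Properties.CommutativeMonoid.Sum +-0-commutativeMonoid
  using (sum-syntax)

infixl 6 _+ᵥ_ _-ᵥ_ _+ₘ_ _-ₘ_
infixr 7 _•ᵥ_ _•ₘ_
infixl 7 _*ᵥ_ _ᵥ*_

-- Every matrix considered here has rational entries, so ℚ stands in for ℝ.
Matrix : ℕ → ℕ → Set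
Matrix m n = Vector (Vector ℚ n) m

ι : ℕ → ℚ
ι n = + n / 1

𝟎 𝟏 : ∀ {n} → Vector ℚ n
𝟎 = replicate _ 0ℚ
𝟏 = replicate _ 1ℚ

_+ᵥ_ _-ᵥ_ : ∀ {n} → Vector ℚ n → Vector ℚ n → Vector ℚ n
_+ᵥ_ = zipWith _+_
_-ᵥ_ = zipWith _-_

_•ᵥ_ : ∀ {n} → ℚ → Vector ℚ n → Vector ℚ n
r •ᵥ v = map (r *_) v

-- The sum runs over k = 1, …, N (not from 0).
∑ᵥ : ∀ {n} → ℕ → (ℕ → Vector ℚ n) → Vector ℚ n
∑ᵥ N f j = ∑[ i < N ] f (suc (toℕ i)) j

_+ₘ_ _-ₘ_ : ∀ {m n} → Matrix m n → Matrix m n → Matrix m n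
_+ₘ_ = zipWith _+ᵥ_
_-ₘ_ = zipWith _-ᵥ_

_•ₘ_ : ∀ {m n} → ℚ → Matrix m n → Matrix m n
r •ₘ A = map (r •ᵥ_) A

_*ᵥ_ : ∀ {m n} → Matrix m n → Vector ℚ n → Vector ℚ m
_*ᵥ_ {n = n} A v i = ∑[ j < n ] (A i j * v j)

_ᵥ*_ : ∀ {m n} → Vector ℚ m → Matrix m n → Vector ℚ n
_ᵥ*_ {m = m} v A j = ∑[ i < m ] (v i * A i j)

IsLaplacianLike : ∀ {n} → Matrix n n → Set
IsLaplacianLike A = (A *ᵥ 𝟏 ≗ 𝟎) × (𝟏 ᵥ* A ≗ 𝟎)

Id : ∀ n → Matrix n n
Id n i j = if does (i Fin.≟ j) then 1ℚ else 0ℚ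

𝟎ₘ : ∀ {m n} → Matrix m n
𝟎ₘ = replicate _ 𝟎

-- [ a  r ]
-- [ c  B ]  with r a row and c a column.
block : ∀ {m n} → ℚ → Vector ℚ n → Vector ℚ m → Matrix m n →
        Matrix (suc m) (suc n)
block a r c B zero    zero    = a
block a r c B zero    (suc j) = r j
block a r c B (suc i) zero    = c i
block a r c B (suc i) (suc j) = B i j

-- (v₁, …, vₘ) ↦ (vₘ, v₁, …, vₘ₋₁)
shiftʳ : ∀ {m} → Vector ℚ m → Vector ℚ m
shiftʳ {suc m} v zero    = v (fromℕ m)
shiftʳ {suc m} v (suc j) = v (inject₁ j)

Circ : ∀ {m} → Vector ℚ m → Matrix m m
Circ c i = fold c shiftʳ (toℕ i)

-- Standard basis vectors are indexed from 1; an index outside 1, …, m would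
-- give the zero vector, but none occurs below.
e : ∀ {m} → ℕ → Vector ℚ m
e i j = if does (suc (toℕ j) ℕ.≟ i) then 1ℚ else 0ℚ

c : ∀ n → ℕ → Vector ℚ (n ∸ 1)
c n k = e (suc k) +ᵥ e (n ∸ k)

-- For n ≡ 1 (mod 3), n ≥ 10, of the parity concerned, all natural-number
-- subtractions and divisions in z₁ and z₂ are exact.

z₁ : ∀ n → Vector ℚ (n ∸ 1)
z₁ n = (ι 2 * ι n - ι n * ι n) •ᵥ e 1
  +ᵥ ∑ᵥ ((n ∸ 4) ℕ./ 6) (λ k →
         ((ι 3 * ι n - ι 18 * ι k + ι 8) * ½) •ᵥ c n (3 ℕ.* k ∸ 2)
      -ᵥ ((ι 3 * ι n - ι 18 * ι k + ι 4) * ½) •ᵥ c n (3 ℕ.* k ∸ 1)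
      +ᵥ c n (3 ℕ.* k))
  +ᵥ c n (n ℕ./ 2 ∸ 1)

z₂ : ∀ n → Vector ℚ (n ∸ 1)
z₂ n = (ι 2 * ι n - ι n * ι n) •ᵥ e 1
  +ᵥ ∑ᵥ ((n ∸ 1) ℕ./ 6) (λ k →
         ((ι 3 * ι n - ι 18 * ι k + ι 8) * ½) •ᵥ c n (3 ℕ.* k ∸ 2)
      -ᵥ ((ι 3 * ι n - ι 18 * ι k + ι 4) * ½) •ᵥ c n (3 ℕ.* k ∸ 1))
  +ᵥ ∑ᵥ ((n ∸ 7) ℕ./ 6) (λ k → c n (3 ℕ.* k))
  +ᵥ e ((n ℕ.+ 1) ℕ./ 2)

P : ∀ n → .{{_ : ℕ.NonZero (n ∸ 1)}} → Matrix (n ∸ 1) (n ∸ 1)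
P n = (+ 1 / (3 ℕ.* (n ∸ 1))) •ₘ Circ (if does (2 ∣? n) then z₁ n else z₂ n)
  where instance _ = ℕ.m*n≢0 3 (n ∸ 1)

-- The bound on n is used only to expose n as 1 + (n − 1) with n − 1 ≠ 0.
L̂ : ∀ n → 10 ≤ n → Matrix n n
L̂ 0                 ()
L̂ 1                 (s≤s ())
L̂ n@(suc (suc n-2)) _ =
     ((ι n - 1ℚ) * (+ 1 / 3)) •ₘ Id n
  -ₘ (+ 1 / 3) •ₘ block 0ℚ 𝟏 𝟏 𝟎ₘ
  +ₘ block 0ℚ 𝟎 𝟎 (P n)

{-# OPTIONS --safe #-}

-- A circulant matrix has all row and column sums equal to the sum of its first
-- row, and each c_k contributes 2 to that sum, so in both parities the entries
-- of z₁ or z₂ add up to −(n − 2)(n − 1).  Hence P has row and column sums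
-- −(n − 2)/3, which cancels (n − 1)/3 − 1/3; the first row and column of L̂
-- vanish in sum because (n − 1)/3 is balanced by n − 1 entries −1/3.

module Submission where

open import Defs
open import Data.Nat.Base using (ℕ; _≤_; _%_)
open import Relation.Binary.PropositionalEquality.Core using (_≡_)

open import Data.Bool.Base using (if_then_else_)
open import Data.Fin.Base using (Fin; zero; suc; toℕ; fromℕ; fromℕ<; inject₁; punchIn)
open import Data.Fin.Induction using (>-weakInduction)
import Data.Fin.Permutation as Perm
import Data.Fin.Properties as Fin
import Data.Integer.Base as ℤ
import Data.Integer.Properties as ℤ
open import Data.List.Base using ([]; _∷_)
open import Data.Nat.Base as ℕ using (zero; suc; _∸_; _<_; z≤n; s≤s)
import Data.Nat.DivMod as ℕ
open import Data.Nat.Divisibility using (_∣_; divides; _∣?_; ∣1⇒≡1; ∣m+n∣m⇒∣n)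
open import Data.Nat.GeneralisedArithmetic using (fold)
import Data.Nat.Properties as ℕ
import Data.Nat.Tactic.RingSolver as ℕ
open import Data.Product.Base using (∃; _,_)
open import Data.Rational.Base using (ℚ; 0ℚ; 1ℚ; ½; _+_; _*_; _-_; -_; _/_; fromℚᵘ; toℚᵘ)
open import Data.Rational.Properties
open import Data.Rational.Solver using (module +-*-Solver)
open import Data.Rational.Unnormalised.Base as ℚᵘ using (mkℚᵘ; *≡*)
import Data.Rational.Unnormalised.Properties as ℚᵘ
open import Data.Sum.Base using (_⊎_; inj₁; inj₂)
open import Data.Vec.Functional using (Vector)
open import Function.Base using (_∘_)
open import Relation.Binary.PropositionalEquality
  using (refl; sym; trans; cong; cong₂; subst; _≢_; _≗_; module ≡-Reasoning)
open import Relation.Nullary.Decidable using (does; dec-true; dec-false)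
open import Relation.Nullary.Negation.Core using (¬_; contradiction)

open import Algebra.Bundles using (module CommutativeRing)
open import Algebra.Properties.Semiring.Sum (CommutativeRing.semiring +-*-commutativeRing)

-- Arithmetic of the embedding `ι` of ℕ into ℚ

-- Transported from `toℚᵘ`, which is injective and respects sums. It lets sums of fractions be
-- computed before reduction to lowest terms.
fromℚᵘ-homo-+ : ∀ p q → fromℚᵘ (p ℚᵘ.+ q) ≡ fromℚᵘ p + fromℚᵘ q
fromℚᵘ-homo-+ p q = toℚᵘ-injective (begin
  toℚᵘ (fromℚᵘ (p ℚᵘ.+ q))                ≈⟨ toℚᵘ-fromℚᵘ (p ℚᵘ.+ q) ⟩
  p ℚᵘ.+ q                                ≈⟨ ℚᵘ.+-cong (toℚᵘ-fromℚᵘ p) (toℚᵘ-fromℚᵘ q) ⟨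
  toℚᵘ (fromℚᵘ p) ℚᵘ.+ toℚᵘ (fromℚᵘ q)    ≈⟨ toℚᵘ-homo-+ (fromℚᵘ p) (fromℚᵘ q) ⟨
  toℚᵘ (fromℚᵘ p + fromℚᵘ q)              ∎)
  where open import Relation.Binary.Reasoning.Setoid ℚᵘ.≃-setoid

fromℚᵘ-homo-* : ∀ p q → fromℚᵘ (p ℚᵘ.* q) ≡ fromℚᵘ p * fromℚᵘ q
fromℚᵘ-homo-* p q = toℚᵘ-injective (begin
  toℚᵘ (fromℚᵘ (p ℚᵘ.* q))                ≈⟨ toℚᵘ-fromℚᵘ (p ℚᵘ.* q) ⟩
  p ℚᵘ.* q                                ≈⟨ ℚᵘ.*-cong (toℚᵘ-fromℚᵘ p) (toℚᵘ-fromℚᵘ q) ⟨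
  toℚᵘ (fromℚᵘ p) ℚᵘ.* toℚᵘ (fromℚᵘ q)    ≈⟨ toℚᵘ-homo-* (fromℚᵘ p) (fromℚᵘ q) ⟨
  toℚᵘ (fromℚᵘ p * fromℚᵘ q)              ∎)
  where open import Relation.Binary.Reasoning.Setoid ℚᵘ.≃-setoid

ι-homo-+ : ∀ m n → ι (m ℕ.+ n) ≡ ι m + ι n
ι-homo-+ m n = trans
  -- The unreduced sum of m/1 and n/1 has numerator m * 1 + n * 1.
  (cong (_/ 1) (cong₂ ℤ._+_ (sym (ℤ.*-identityʳ (ℤ.+ m))) (sym (ℤ.*-identityʳ (ℤ.+ n)))))
  (fromℚᵘ-homo-+ (mkℚᵘ (ℤ.+ m) 0) (mkℚᵘ (ℤ.+ n) 0))

ι-homo-* : ∀ m n → ι (m ℕ.* n) ≡ ι m * ι n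
ι-homo-* m n = trans (cong (_/ 1) (ℤ.pos-* m n)) (fromℚᵘ-homo-* (mkℚᵘ (ℤ.+ m) 0) (mkℚᵘ (ℤ.+ n) 0))

1/n*n≡1 : ∀ n .{{_ : ℕ.NonZero n}} → (ℤ.+ 1 / n) * ι n ≡ 1ℚ
1/n*n≡1 n@(suc n-1) = trans (sym (fromℚᵘ-homo-* (mkℚᵘ (ℤ.+ 1) n-1) (mkℚᵘ (ℤ.+ n) 0)))
  (fromℚᵘ-cong {mkℚᵘ (ℤ.+ 1) n-1 ℚᵘ.* mkℚᵘ (ℤ.+ n) 0} {ℚᵘ.1ℚᵘ}
    (*≡* (cong ℤ.+_ (ℕ.solve (n-1 ∷ [])))))

-- Entry sums of vectors

sum-neg : ∀ {n} (v : Vector ℚ n) → sum (λ i → - v i) ≡ - sum v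
sum-neg {zero}  v = refl
sum-neg {suc n} v = trans (cong (- v zero +_) (sum-neg (v ∘ suc))) (sym (neg-distrib-+ (v zero) (sum (v ∘ suc))))

sum-+ᵥ : ∀ {n} (u v : Vector ℚ n) → sum (u +ᵥ v) ≡ sum u + sum v
sum-+ᵥ = ∑-distrib-+

sum--ᵥ : ∀ {n} (u v : Vector ℚ n) → sum (u -ᵥ v) ≡ sum u - sum v
sum--ᵥ u v = trans (∑-distrib-+ u (λ i → - v i)) (cong (sum u +_) (sum-neg v))

sum-•ᵥ : ∀ {n} r (v : Vector ℚ n) → sum (r •ᵥ v) ≡ r * sum v
sum-•ᵥ r v = sym (*-distribˡ-sum r v)

sum-∑ᵥ : ∀ {n} N (f : ℕ → Vector ℚ n) → sum (∑ᵥ N f) ≡ ∑[ i < N ] sum (f (suc (toℕ i)))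
sum-∑ᵥ {n} N f = ∑-comm {n} {N} (λ j i → f (suc (toℕ i)) j)

sum-const : ∀ n x → ∑[ i < n ] x ≡ ι n * x
sum-const zero    x = sym (*-zeroˡ x)
sum-const (suc n) x = begin
  x + ∑[ i < n ] x    ≡⟨ cong (x +_) (sum-const n x) ⟩
  x + ι n * x         ≡⟨ solve 2 (λ x k → x :+ k :* x := (con 1ℚ :+ k) :* x) refl x (ι n) ⟩
  (1ℚ + ι n) * x      ≡⟨ cong (_* x) (ι-homo-+ 1 n) ⟨
  ι (suc n) * x       ∎
  where open ≡-Reasoning; open +-*-Solver

sum-concentrated : ∀ {n} (v : Vector ℚ n) k → (∀ j → j ≢ k → v j ≡ 0ℚ) → sum v ≡ v k
sum-concentrated {suc n} v k v≡0 = begin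
  sum v                            ≡⟨ sum-remove {i = k} v ⟩
  v k + sum (v ∘ punchIn k)        ≡⟨ cong (λ x → v k + x) (trans
    (sum-cong-≗ λ j → v≡0 (punchIn k j) (Fin.punchInᵢ≢i k j)) (sum-replicate-zero n)) ⟩
  v k + 0ℚ                         ≡⟨ +-identityʳ (v k) ⟩
  v k                              ∎
  where open ≡-Reasoning

-- The bounds ensure that index i names an actual coordinate; otherwise the vector would be zero.
sum-e : ∀ {m i} → 1 ≤ i → i ≤ m → sum (e {m} i) ≡ 1ℚ
sum-e {m} {suc i} (s≤s z≤n) i<m = trans (sum-concentrated (e (suc i)) k off) on
  where
  k = fromℕ< i<m
  on : e (suc i) k ≡ 1ℚ
  on = cong (if_then 1ℚ else 0ℚ) (dec-true (suc (toℕ k) ℕ.≟ suc i) (cong suc (Fin.toℕ-fromℕ< i<m)))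
  off : ∀ j → j ≢ k → e (suc i) j ≡ 0ℚ
  off j j≢k = cong (if_then 1ℚ else 0ℚ) (dec-false (suc (toℕ j) ℕ.≟ suc i) λ eq →
    j≢k (Fin.toℕ-injective (trans (ℕ.suc-injective eq) (sym (Fin.toℕ-fromℕ< i<m)))))

sum-Id-row : ∀ {n} (i : Fin n) → ∑[ j < n ] Id n i j ≡ 1ℚ
sum-Id-row {n} i = trans
  (sum-concentrated (Id n i) i λ j j≢i →
    cong (if_then 1ℚ else 0ℚ) (dec-false (i Fin.≟ j) (j≢i ∘ sym)))
  (cong (if_then 1ℚ else 0ℚ) (dec-true (i Fin.≟ i) refl))

sum-Id-column : ∀ {n} (j : Fin n) → ∑[ i < n ] Id n i j ≡ 1ℚ
sum-Id-column {n} j = trans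
  (sum-concentrated (λ i → Id n i j) j λ i i≢j →
    cong (if_then 1ℚ else 0ℚ) (dec-false (i Fin.≟ j) i≢j))
  (cong (if_then 1ℚ else 0ℚ) (dec-true (j Fin.≟ j) refl))

-- Circulant matrices

sum-shiftʳ : ∀ {m} (v : Vector ℚ m) → sum (shiftʳ v) ≡ sum v
sum-shiftʳ {zero}  v = refl
sum-shiftʳ {suc m} v = trans (+-comm (v (fromℕ m)) _) (sym (sum-init-last v))

sum-Circ-row : ∀ {m} (v : Vector ℚ m) i → ∑[ j < m ] Circ v i j ≡ sum v
sum-Circ-row v i = shifts (toℕ i)
  where
  shifts : ∀ k → sum (fold v shiftʳ k) ≡ sum v
  shifts zero    = refl
  shifts (suc k) = trans (sum-shiftʳ (fold v shiftʳ k)) (shifts k)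

-- A right shift moves each entry one place on, so i shifts take position k to k + i while this
-- stays within the vector. An equation between indices avoids truncated subtraction.
shifts-before-wrap : ∀ {m} (v : Vector ℚ m) i {j k} → toℕ j ≡ i ℕ.+ toℕ k → fold v shiftʳ i j ≡ v k
shifts-before-wrap v zero    j≡k = cong v (Fin.toℕ-injective j≡k)
shifts-before-wrap v (suc i) {suc j} j≡i+k =
  shifts-before-wrap v i (trans (Fin.toℕ-inject₁ j) (ℕ.suc-injective j≡i+k))

-- Here the entry from position k has passed the end exactly once. Undoing shifts leads back to
-- position 0, where the wrap occurred; before it the previous lemma applies.
shifts-after-wrap : ∀ {m} (v : Vector ℚ m) i {j k} → m ℕ.+ toℕ j ≡ i ℕ.+ toℕ k → fold v shiftʳ i j ≡ v k
shifts-after-wrap {m} v zero {j} {k} m+j≡k =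
  contradiction (Fin.toℕ<n k) (ℕ.≤⇒≯ (subst (m ≤_) m+j≡k (ℕ.m≤m+n m (toℕ j))))
shifts-after-wrap {suc m} v (suc i) {zero} m≡i+k = shifts-before-wrap v i
  (trans (Fin.toℕ-fromℕ m) (trans (sym (ℕ.+-identityʳ m)) (ℕ.suc-injective m≡i+k)))
shifts-after-wrap {suc m} v (suc i) {suc j} m+j≡i+k = shifts-after-wrap v i
  (trans (cong (suc m ℕ.+_) (Fin.toℕ-inject₁ j))
    (trans (sym (ℕ.+-suc m (toℕ j))) (ℕ.suc-injective m+j≡i+k)))

-- The windows 1, ..., m and 0, ..., m - 1 differ only by exchanging `g m` for `g 0`.
sum-cyclic : ∀ m (g : ℕ → ℚ) → g m ≡ g 0 → ∑[ i < m ] g (suc (toℕ i)) ≡ ∑[ i < m ] g (toℕ i)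
sum-cyclic zero    g _     = refl
sum-cyclic (suc m) g gm≡g0 = begin
  ∑[ i < suc m ] g (suc (toℕ i))
    ≡⟨ sum-init-last {m} (λ i → g (suc (toℕ i))) ⟩
  ∑[ i < m ] g (suc (toℕ (inject₁ i))) + g (suc (toℕ (fromℕ m)))
    ≡⟨ cong₂ _+_ (sum-cong-≗ {m} λ i → cong (g ∘ suc) (Fin.toℕ-inject₁ i))
                 (trans (cong (g ∘ suc) (Fin.toℕ-fromℕ m)) gm≡g0) ⟩
  ∑[ i < m ] g (suc (toℕ i)) + g 0
    ≡⟨ +-comm _ (g 0) ⟩
  ∑[ i < suc m ] g (toℕ i) ∎
  where open ≡-Reasoning

-- The last column is v reversed; all column sums agree because shifting m times is the identity.
sum-Circ-column : ∀ {m} (v : Vector ℚ m) j → ∑[ i < m ] Circ v i j ≡ sum v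
sum-Circ-column {suc m} v =
  >-weakInduction (λ j → ∑[ i < suc m ] Circ v i j ≡ sum v) last-column previous-column
  where
  last-column : ∑[ i < suc m ] Circ v i (fromℕ m) ≡ sum v
  last-column = trans
    (sum-cong-≗ {suc m} λ i → shifts-before-wrap v (toℕ i)
      (trans (Fin.toℕ-fromℕ m) (trans (sym (ℕ.m+[n∸m]≡n (ℕ.≤-pred (Fin.toℕ<n i))))
        (cong (toℕ i ℕ.+_) (sym (Fin.opposite-prop i))))))
    (sym (sum-permute v Perm.reverse))
  previous-column : ∀ j → ∑[ i < suc m ] Circ v i (suc j) ≡ sum v →
                    ∑[ i < suc m ] Circ v i (inject₁ j) ≡ sum v
  previous-column j = trans
    -- Row i + 1 at column j + 1 is by definition row i at column j, so neighbouring columns are two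
    -- windows of one periodic sequence.
    (sum-cyclic (suc m) (λ i → fold v shiftʳ i (suc j)) (shifts-after-wrap v (suc m) refl))

-- The first rows z₁ and z₂

-- Both k + 1 and n - k lie between 1 and n - 1, so each basis vector contributes 1, even if the two
-- coincide.
sum-c : ∀ {n k} → 1 ≤ k → suc k ≤ n ∸ 1 → sum (c n k) ≡ ι 2
sum-c {n} {k} 1≤k k<n-1 = trans (sum-+ᵥ {n ∸ 1} (e (suc k)) (e (n ∸ k))) (cong₂ _+_
  (sum-e (s≤s z≤n) k<n-1)
  (sum-e (ℕ.m<n⇒0<n∸m (ℕ.≤-trans k<n-1 (ℕ.m∸n≤m n 1))) (ℕ.∸-monoʳ-≤ n 1≤k)))

-- The two coefficients differ by (8 - 4)/2 = 2 and each c-vector sums to 2, so n and k cancel.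
sum-c-pair : ∀ n k → 1 ≤ k → suc (3 ℕ.* k) ≤ n ∸ 1 →
  sum (((ι 3 * ι n - ι 18 * ι k + ι 8) * ½) •ᵥ c n (3 ℕ.* k ∸ 2)
    -ᵥ ((ι 3 * ι n - ι 18 * ι k + ι 4) * ½) •ᵥ c n (3 ℕ.* k ∸ 1)) ≡ ι 4
sum-c-pair n k 1≤k 3k<n-1 = begin
  sum (a •ᵥ c₋₂ -ᵥ b •ᵥ c₋₁)       ≡⟨ sum--ᵥ (a •ᵥ c₋₂) (b •ᵥ c₋₁) ⟩
  sum (a •ᵥ c₋₂) - sum (b •ᵥ c₋₁)  ≡⟨ cong₂ _-_ (sum-•ᵥ a c₋₂) (sum-•ᵥ b c₋₁) ⟩
  a * sum c₋₂ - b * sum c₋₁        ≡⟨ cong₂ (λ x y → a * x - b * y) (sum-c₋ 2 3≤3k)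
                                        (sum-c₋ 1 (ℕ.≤-trans (s≤s (s≤s z≤n)) 3≤3k)) ⟩
  a * ι 2 - b * ι 2                ≡⟨ solve 2 (λ n k →
      (con (ι 3) :* n :- con (ι 18) :* k :+ con (ι 8)) :* con ½ :* con (ι 2)
      :- (con (ι 3) :* n :- con (ι 18) :* k :+ con (ι 4)) :* con ½ :* con (ι 2) := con (ι 4)) refl (ι n) (ι k) ⟩
  ι 4 ∎
  where
  open ≡-Reasoning
  open +-*-Solver
  a b : ℚ
  a = (ι 3 * ι n - ι 18 * ι k + ι 8) * ½
  b = (ι 3 * ι n - ι 18 * ι k + ι 4) * ½
  c₋₂ c₋₁ : Vector ℚ (n ∸ 1)
  c₋₂ = c n (3 ℕ.* k ∸ 2)
  c₋₁ = c n (3 ℕ.* k ∸ 1)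
  3≤3k : 3 ≤ 3 ℕ.* k
  3≤3k = ℕ.*-monoʳ-≤ 3 1≤k
  -- The bound on d keeps the truncated difference positive, as `sum-c` requires.
  sum-c₋ : ∀ d → d < 3 ℕ.* k → sum (c n (3 ℕ.* k ∸ d)) ≡ ι 2
  sum-c₋ d d<3k = sum-c {n} (ℕ.m<n⇒0<n∸m d<3k) (ℕ.≤-trans (s≤s (ℕ.m∸n≤m (3 ℕ.* k) d)) 3k<n-1)

sum-c-triple : ∀ n k → 1 ≤ k → suc (3 ℕ.* k) ≤ n ∸ 1 →
  sum (((ι 3 * ι n - ι 18 * ι k + ι 8) * ½) •ᵥ c n (3 ℕ.* k ∸ 2)
    -ᵥ ((ι 3 * ι n - ι 18 * ι k + ι 4) * ½) •ᵥ c n (3 ℕ.* k ∸ 1)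
    +ᵥ c n (3 ℕ.* k)) ≡ ι 6
sum-c-triple n k 1≤k 3k<n-1 = trans (sum-+ᵥ _ (c n (3 ℕ.* k)))
  (cong₂ _+_ (sum-c-pair n k 1≤k 3k<n-1) (sum-c {n} (ℕ.≤-trans 1≤k (ℕ.m≤m+n k _)) 3k<n-1))

sum-∑ᵥ-const : ∀ {n} N (f : ℕ → Vector ℚ n) x →
               (∀ k → 1 ≤ k → k ≤ N → sum (f k) ≡ x) → sum (∑ᵥ N f) ≡ ι N * x
sum-∑ᵥ-const N f x sum-f≡x = trans (sum-∑ᵥ N f) (trans
  (sum-cong-≗ {N} λ i → sum-f≡x (suc (toℕ i)) (s≤s z≤n) (Fin.toℕ<n i))
  (sum-const N x))

-- Keeps all c-indices in range for both parities: n - 1 is 9 + 6s for even n and 12 + 6s for odd n,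
-- and no summation limit exceeds s + 2.
1+3k≤9+6s : ∀ {s k} → k ≤ 2 ℕ.+ s → suc (3 ℕ.* k) ≤ 9 ℕ.+ s ℕ.* 6
1+3k≤9+6s {s} {k} k≤2+s = begin
  suc (3 ℕ.* k)                      ≤⟨ s≤s (ℕ.*-monoʳ-≤ 3 k≤2+s) ⟩
  suc (3 ℕ.* (2 ℕ.+ s))              ≤⟨ ℕ.m≤m+n _ (2 ℕ.+ s ℕ.* 3) ⟩
  suc (3 ℕ.* (2 ℕ.+ s)) ℕ.+ (2 ℕ.+ s ℕ.* 3) ≡⟨ ℕ.solve (s ∷ []) ⟩
  9 ℕ.+ s ℕ.* 6                      ∎
  where open ℕ.≤-Reasoning

-- There are s + 1 = (n - 4)/6 triples of sum 6, and the last c adds 2: the total 2n - n² + (n - 4)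
-- + 2 factors as stated.
sum-z₁ : ∀ s → let n = 10 ℕ.+ s ℕ.* 6 in sum (z₁ n) ≡ (ι 2 - ι n) * (ι n - 1ℚ)
sum-z₁ s = begin
  sum (z₁ n)
    ≡⟨ trans (sum-+ᵥ (u +ᵥ ∑ᵥ N f) l) (cong (_+ sum l) (sum-+ᵥ u (∑ᵥ N f))) ⟩
  sum u + sum (∑ᵥ N f) + sum l
    ≡⟨ cong₂ _+_ (cong₂ _+_ sum-u sum-f) sum-l ⟩
  d * 1ℚ + ι (suc s) * ι 6 + ι 2
    ≡⟨ cong₂ (λ x y → (ι 2 * x - x * x) * 1ℚ + y * ι 6 + ι 2) ιn (ι-homo-+ 1 s) ⟩
  (ι 2 * x - x * x) * 1ℚ + (1ℚ + ι s) * ι 6 + ι 2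
    ≡⟨ solve 1 (λ s → let x = con (ι 10) :+ s :* con (ι 6) in
         (con (ι 2) :* x :- x :* x) :* con 1ℚ :+ (con 1ℚ :+ s) :* con (ι 6) :+ con (ι 2)
         := (con (ι 2) :- x) :* (x :- con 1ℚ)) refl (ι s) ⟩
  (ι 2 - x) * (x - 1ℚ)
    ≡⟨ cong (λ x → (ι 2 - x) * (x - 1ℚ)) (sym ιn) ⟩
  (ι 2 - ι n) * (ι n - 1ℚ) ∎
  where
  open ≡-Reasoning
  open +-*-Solver
  n N : ℕ
  n = 10 ℕ.+ s ℕ.* 6
  N = (n ∸ 4) ℕ./ 6
  d x : ℚ
  d = ι 2 * ι n - ι n * ι n
  x = ι 10 + ι s * ι 6
  ιn : ι n ≡ x
  ιn = trans (ι-homo-+ 10 (s ℕ.* 6)) (cong (λ y → ι 10 + y) (ι-homo-* s 6))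
  f : ℕ → Vector ℚ (n ∸ 1)
  f k = ((ι 3 * ι n - ι 18 * ι k + ι 8) * ½) •ᵥ c n (3 ℕ.* k ∸ 2)
     -ᵥ ((ι 3 * ι n - ι 18 * ι k + ι 4) * ½) •ᵥ c n (3 ℕ.* k ∸ 1)
     +ᵥ c n (3 ℕ.* k)
  u l : Vector ℚ (n ∸ 1)
  u = d •ᵥ e 1
  l = c n (n ℕ./ 2 ∸ 1)
  N≡1+s : N ≡ suc s
  N≡1+s = ℕ.m*n/n≡m (suc s) 6
  n/2≡5+3s : n ℕ./ 2 ≡ 5 ℕ.+ s ℕ.* 3
  -- Writing s * 6 as s * 3 * 2 lets the sum compute to a multiple of 2.
  n/2≡5+3s = trans (ℕ./-congˡ {o = 2} (cong (10 ℕ.+_) (sym (ℕ.*-assoc s 3 2))))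
    (ℕ.m*n/n≡m (5 ℕ.+ s ℕ.* 3) 2)
  sum-u : sum u ≡ d * 1ℚ
  sum-u = trans (sum-•ᵥ d (e {n ∸ 1} 1)) (cong (d *_) (sum-e {n ∸ 1} (s≤s z≤n) (s≤s z≤n)))
  sum-f : sum (∑ᵥ N f) ≡ ι (suc s) * ι 6
  sum-f = trans
    (sum-∑ᵥ-const N f (ι 6) λ k 1≤k k≤N → sum-c-triple n k 1≤k
      (1+3k≤9+6s {s} (ℕ.≤-trans k≤N (ℕ.≤-trans (ℕ.≤-reflexive N≡1+s) (ℕ.n≤1+n (suc s))))))
    (cong (λ N → ι N * ι 6) N≡1+s)
  sum-l : sum l ≡ ι 2
  sum-l = trans (cong (λ h → sum (c n (h ∸ 1))) n/2≡5+3s)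
    (sum-c {n} {4 ℕ.+ s ℕ.* 3} (s≤s z≤n)
      (ℕ.+-mono-≤ {5} {9} (ℕ.m≤m+n 5 4) (ℕ.*-monoʳ-≤ s {3} {6} (ℕ.m≤m+n 3 3))))

-- The s + 2 pairs give 4 each, the s + 1 further c-vectors 2 each, and the central basis vector 1:
-- together 6s + 11 = n - 2, to be added to 2n - n².
sum-z₂ : ∀ s → let n = 13 ℕ.+ s ℕ.* 6 in sum (z₂ n) ≡ (ι 2 - ι n) * (ι n - 1ℚ)
sum-z₂ s = begin
  sum (z₂ n)
    ≡⟨ trans (sum-+ᵥ (u +ᵥ ∑ᵥ N f +ᵥ ∑ᵥ M g) l) (cong (_+ sum l)
         (trans (sum-+ᵥ (u +ᵥ ∑ᵥ N f) (∑ᵥ M g)) (cong (_+ sum (∑ᵥ M g)) (sum-+ᵥ u (∑ᵥ N f))))) ⟩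
  sum u + sum (∑ᵥ N f) + sum (∑ᵥ M g) + sum l
    ≡⟨ cong₂ _+_ (cong₂ _+_ (cong₂ _+_ sum-u sum-f) sum-g) sum-l ⟩
  d * 1ℚ + ι (2 ℕ.+ s) * ι 4 + ι (1 ℕ.+ s) * ι 2 + 1ℚ
    ≡⟨ cong₂ (λ x (y , z) → (ι 2 * x - x * x) * 1ℚ + y * ι 4 + z * ι 2 + 1ℚ)
         ιn (cong₂ _,_ (ι-homo-+ 2 s) (ι-homo-+ 1 s)) ⟩
  (ι 2 * x - x * x) * 1ℚ + (ι 2 + ι s) * ι 4 + (1ℚ + ι s) * ι 2 + 1ℚ
    ≡⟨ solve 1 (λ s → let x = con (ι 13) :+ s :* con (ι 6) in
         (con (ι 2) :* x :- x :* x) :* con 1ℚ :+ (con (ι 2) :+ s) :* con (ι 4)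
         :+ (con 1ℚ :+ s) :* con (ι 2) :+ con 1ℚ
         := (con (ι 2) :- x) :* (x :- con 1ℚ)) refl (ι s) ⟩
  (ι 2 - x) * (x - 1ℚ)
    ≡⟨ cong (λ x → (ι 2 - x) * (x - 1ℚ)) (sym ιn) ⟩
  (ι 2 - ι n) * (ι n - 1ℚ) ∎
  where
  open ≡-Reasoning
  open +-*-Solver
  n N M : ℕ
  n = 13 ℕ.+ s ℕ.* 6
  N = (n ∸ 1) ℕ./ 6
  M = (n ∸ 7) ℕ./ 6
  d x : ℚ
  d = ι 2 * ι n - ι n * ι n
  x = ι 13 + ι s * ι 6
  ιn : ι n ≡ x
  ιn = trans (ι-homo-+ 13 (s ℕ.* 6)) (cong (λ y → ι 13 + y) (ι-homo-* s 6))
  f g : ℕ → Vector ℚ (n ∸ 1)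
  f k = ((ι 3 * ι n - ι 18 * ι k + ι 8) * ½) •ᵥ c n (3 ℕ.* k ∸ 2)
     -ᵥ ((ι 3 * ι n - ι 18 * ι k + ι 4) * ½) •ᵥ c n (3 ℕ.* k ∸ 1)
  g k = c n (3 ℕ.* k)
  u l : Vector ℚ (n ∸ 1)
  u = d •ᵥ e 1
  l = e ((n ℕ.+ 1) ℕ./ 2)
  N≡2+s : N ≡ 2 ℕ.+ s
  N≡2+s = ℕ.m*n/n≡m (2 ℕ.+ s) 6
  M≡1+s : M ≡ 1 ℕ.+ s
  M≡1+s = ℕ.m*n/n≡m (1 ℕ.+ s) 6
  [n+1]/2≡7+3s : (n ℕ.+ 1) ℕ./ 2 ≡ 7 ℕ.+ s ℕ.* 3
  [n+1]/2≡7+3s = trans (ℕ./-congˡ {o = 2} (trans (ℕ.+-comm n 1) (cong (14 ℕ.+_) (sym (ℕ.*-assoc s 3 2)))))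
    (ℕ.m*n/n≡m (7 ℕ.+ s ℕ.* 3) 2)
  in-range : ∀ {k} → k ≤ 2 ℕ.+ s → suc (3 ℕ.* k) ≤ n ∸ 1
  in-range k≤2+s = ℕ.≤-trans (1+3k≤9+6s {s} k≤2+s) (ℕ.m≤n+m _ 3)
  sum-u : sum u ≡ d * 1ℚ
  sum-u = trans (sum-•ᵥ d (e {n ∸ 1} 1)) (cong (d *_) (sum-e {n ∸ 1} (s≤s z≤n) (s≤s z≤n)))
  sum-f : sum (∑ᵥ N f) ≡ ι (2 ℕ.+ s) * ι 4
  sum-f = trans
    (sum-∑ᵥ-const N f (ι 4) λ k 1≤k k≤N → sum-c-pair n k 1≤k
      (in-range (ℕ.≤-trans k≤N (ℕ.≤-reflexive N≡2+s))))
    (cong (λ N → ι N * ι 4) N≡2+s)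
  sum-g : sum (∑ᵥ M g) ≡ ι (1 ℕ.+ s) * ι 2
  sum-g = trans
    (sum-∑ᵥ-const M g (ι 2) λ k 1≤k k≤M → sum-c {n} (ℕ.≤-trans 1≤k (ℕ.m≤m+n k _))
      (in-range (ℕ.≤-trans k≤M (ℕ.≤-trans (ℕ.≤-reflexive M≡1+s) (ℕ.n≤1+n (suc s))))))
    (cong (λ M → ι M * ι 2) M≡1+s)
  sum-l : sum l ≡ 1ℚ
  sum-l = trans (cong (λ h → sum (e {n ∸ 1} h)) [n+1]/2≡7+3s)
    (sum-e {n ∸ 1} (s≤s z≤n)
      (ℕ.+-mono-≤ {7} {12} (ℕ.m≤m+n 7 5) (ℕ.*-monoʳ-≤ s {3} {6} (ℕ.m≤m+n 3 3))))

-- The rows and columns of L̂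

-- Stated for arbitrary vectors so that it serves the rows of `L̂` as well as its columns.
sum-combination : ∀ {n} a b (u v w : Vector ℚ n) →
                  sum (a •ᵥ u -ᵥ b •ᵥ v +ᵥ w) ≡ a * sum u - b * sum v + sum w
sum-combination a b u v w = trans (sum-+ᵥ (a •ᵥ u -ᵥ b •ᵥ v) w)
  (cong (_+ sum w) (trans (sum--ᵥ (a •ᵥ u) (b •ᵥ v)) (cong₂ _-_ (sum-•ᵥ a u) (sum-•ᵥ b v))))

-- Parity enters only through the sum of the first row of the circulant, taken here as a hypothesis.
-- Writing n as 2 + m makes `L̂` unfold.
L̂-laplacianLike : ∀ m (10≤n : 10 ≤ 2 ℕ.+ m) → let n = 2 ℕ.+ m in
  sum (if does (2 ∣? n) then z₁ n else z₂ n) ≡ (ι 2 - ι n) * (ι n - 1ℚ) →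
  IsLaplacianLike (L̂ n 10≤n)
L̂-laplacianLike m 10≤n sum-z = rows , columns
  where
  open ≡-Reasoning
  open +-*-Solver

  n n-1 : ℕ
  n = 2 ℕ.+ m
  n-1 = 1 ℕ.+ m

  z : Vector ℚ n-1
  z = if does (2 ∣? n) then z₁ n else z₂ n

  a ⅓ p x : ℚ
  a = (ι n - 1ℚ) * ⅓
  ⅓ = ℤ.+ 1 / 3
  p = ℤ.+ 1 / (3 ℕ.* n-1)
  x = ι n-1

  J B : Matrix n n
  J = block 0ℚ 𝟏 𝟏 𝟎ₘ
  B = block 0ℚ 𝟎 𝟎 (P n)

  ιn : ι n ≡ 1ℚ + x
  ιn = ι-homo-+ 1 n-1

  p*3x≡1 : p * (ι 3 * x) ≡ 1ℚ
  p*3x≡1 = trans (cong (p *_) (sym (ι-homo-* 3 n-1))) (1/n*n≡1 (3 ℕ.* n-1))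

  border : a * 1ℚ - ⅓ * (0ℚ + ∑[ i < n-1 ] 1ℚ) + (0ℚ + ∑[ i < n-1 ] 0ℚ) ≡ 0ℚ
  border = begin
    a * 1ℚ - ⅓ * (0ℚ + ∑[ i < n-1 ] 1ℚ) + (0ℚ + ∑[ i < n-1 ] 0ℚ)
      ≡⟨ cong₂ (λ y w → a * 1ℚ - ⅓ * (0ℚ + y) + (0ℚ + w)) (sum-const n-1 1ℚ) (sum-replicate-zero n-1) ⟩
    a * 1ℚ - ⅓ * (0ℚ + x * 1ℚ) + (0ℚ + 0ℚ)
      ≡⟨ cong (λ y → (y - 1ℚ) * ⅓ * 1ℚ - ⅓ * (0ℚ + x * 1ℚ) + (0ℚ + 0ℚ)) ιn ⟩
    (1ℚ + x - 1ℚ) * ⅓ * 1ℚ - ⅓ * (0ℚ + x * 1ℚ) + (0ℚ + 0ℚ)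
      ≡⟨ solve 1 (λ x → (con 1ℚ :+ x :- con 1ℚ) :* con ⅓ :* con 1ℚ
           :- con ⅓ :* (con 0ℚ :+ x :* con 1ℚ) :+ (con 0ℚ :+ con 0ℚ) := con 0ℚ) refl x ⟩
    0ℚ ∎

  interior : a * 1ℚ - ⅓ * (1ℚ + ∑[ i < n-1 ] 0ℚ) + (0ℚ + p * sum z) ≡ 0ℚ
  interior = begin
    a * 1ℚ - ⅓ * (1ℚ + ∑[ i < n-1 ] 0ℚ) + (0ℚ + p * sum z)
      ≡⟨ cong₂ (λ y w → a * 1ℚ - ⅓ * (1ℚ + y) + (0ℚ + p * w)) (sum-replicate-zero n-1) sum-z ⟩
    a * 1ℚ - ⅓ * (1ℚ + 0ℚ) + (0ℚ + p * ((ι 2 - ι n) * (ι n - 1ℚ)))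
      ≡⟨ cong (λ y → (y - 1ℚ) * ⅓ * 1ℚ - ⅓ * (1ℚ + 0ℚ) + (0ℚ + p * ((ι 2 - y) * (y - 1ℚ)))) ιn ⟩
    (1ℚ + x - 1ℚ) * ⅓ * 1ℚ - ⅓ * (1ℚ + 0ℚ) + (0ℚ + p * ((ι 2 - (1ℚ + x)) * (1ℚ + x - 1ℚ)))
      -- The solver treats p as an independent variable; the factor 1 - 3px is split off because it
      -- vanishes for p = 1/(3x).
      ≡⟨ solve 2 (λ p x →
           (con 1ℚ :+ x :- con 1ℚ) :* con ⅓ :* con 1ℚ :- con ⅓ :* (con 1ℚ :+ con 0ℚ)
           :+ (con 0ℚ :+ p :* ((con (ι 2) :- (con 1ℚ :+ x)) :* (con 1ℚ :+ x :- con 1ℚ)))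
           := con ⅓ :* (x :- con 1ℚ) :* (con 1ℚ :- p :* (con (ι 3) :* x))) refl p x ⟩
    ⅓ * (x - 1ℚ) * (1ℚ - p * (ι 3 * x))
      ≡⟨ cong (λ y → ⅓ * (x - 1ℚ) * (1ℚ - y)) p*3x≡1 ⟩
    ⅓ * (x - 1ℚ) * 0ℚ
      ≡⟨ *-zeroʳ (⅓ * (x - 1ℚ)) ⟩
    0ℚ ∎

  row : ∀ i → sum (L̂ n 10≤n i) ≡ a * 1ℚ - ⅓ * sum (J i) + sum (B i)
  row i = trans (sum-combination a ⅓ (Id n i) (J i) (B i))
    (cong (λ y → a * y - ⅓ * sum (J i) + sum (B i)) (sum-Id-row i))

  column : ∀ j → ∑[ i < n ] L̂ n 10≤n i j ≡ a * 1ℚ - ⅓ * ∑[ i < n ] J i j + ∑[ i < n ] B i j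
  column j = trans (sum-combination a ⅓ (λ i → Id n i j) (λ i → J i j) (λ i → B i j))
    (cong (λ y → a * y - ⅓ * ∑[ i < n ] J i j + ∑[ i < n ] B i j) (sum-Id-column j))

  sum-P-row : ∀ i → ∑[ j < n-1 ] P n i j ≡ p * sum z
  sum-P-row i = trans (sum-•ᵥ p (Circ z i)) (cong (p *_) (sum-Circ-row z i))

  sum-P-column : ∀ j → ∑[ i < n-1 ] P n i j ≡ p * sum z
  sum-P-column j = trans (sum-•ᵥ p (λ i → Circ z i j)) (cong (p *_) (sum-Circ-column z j))

  rows : L̂ n 10≤n *ᵥ 𝟏 ≗ 𝟎
  rows i = trans (sum-cong-≗ {n} λ j → *-identityʳ (L̂ n 10≤n i j)) (trans (row i) (entries i))
    where
    entries : ∀ i → a * 1ℚ - ⅓ * sum (J i) + sum (B i) ≡ 0ℚ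
    entries zero    = border
    entries (suc i) = trans
      (cong (λ y → a * 1ℚ - ⅓ * (1ℚ + ∑[ i < n-1 ] 0ℚ) + (0ℚ + y)) (sum-P-row i)) interior

  columns : 𝟏 ᵥ* L̂ n 10≤n ≗ 𝟎
  columns j = trans (sum-cong-≗ {n} λ i → *-identityˡ (L̂ n 10≤n i j)) (trans (column j) (entries j))
    where
    entries : ∀ j → a * 1ℚ - ⅓ * ∑[ i < n ] J i j + ∑[ i < n ] B i j ≡ 0ℚ
    -- The bordering row and column agree, so column sums unfold to the same expressions as row
    -- sums.
    entries zero    = border
    entries (suc j) = trans
      (cong (λ y → a * 1ℚ - ⅓ * (1ℚ + ∑[ i < n-1 ] 0ℚ) + (0ℚ + y)) (sum-P-column j)) interior

-- Residues of n and the choice of parity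

even-or-odd : ∀ n → ∃ (λ r → n ≡ r ℕ.* 2) ⊎ ∃ (λ r → n ≡ suc (r ℕ.* 2))
even-or-odd zero = inj₁ (0 , refl)
even-or-odd (suc n) with even-or-odd n
... | inj₁ (r , n≡2r)   = inj₂ (r , cong suc n≡2r)
... | inj₂ (r , n≡2r+1) = inj₁ (suc r , cong suc n≡2r+1)

residues-mod-6 : ∀ {n} → 10 ≤ n → n % 3 ≡ 1 →
                 ∃ (λ s → n ≡ 10 ℕ.+ s ℕ.* 6) ⊎ ∃ (λ s → n ≡ 13 ℕ.+ s ℕ.* 6)
-- Since 10 / 3 computes to 3, the quotient n / 3 is 3 + t, whence n = 1 + 3(3 + t) = 10 + 3t; the
-- parity of t then decides the case.
residues-mod-6 {n} 10≤n n%3≡1 with ℕ.m≤n⇒∃[o]m+o≡n (ℕ./-monoˡ-≤ 3 10≤n)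
... | t , 3+t≡n/3 = by-parity (even-or-odd t)
  where
  n≡10+3t : n ≡ 10 ℕ.+ t ℕ.* 3
  n≡10+3t = trans (ℕ.m≡m%n+[m/n]*n n 3) (cong₂ (λ r q → r ℕ.+ q ℕ.* 3) n%3≡1 (sym 3+t≡n/3))
  by-parity : ∃ (λ r → t ≡ r ℕ.* 2) ⊎ ∃ (λ r → t ≡ suc (r ℕ.* 2)) →
              ∃ (λ s → n ≡ 10 ℕ.+ s ℕ.* 6) ⊎ ∃ (λ s → n ≡ 13 ℕ.+ s ℕ.* 6)
  by-parity (inj₁ (r , refl)) = inj₁ (r , trans n≡10+3t (cong (10 ℕ.+_) (ℕ.*-assoc r 2 3)))
  by-parity (inj₂ (r , refl)) = inj₂ (r , trans n≡10+3t (cong (13 ℕ.+_) (ℕ.*-assoc r 2 3)))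

2∣10+6s : ∀ s → 2 ∣ 10 ℕ.+ s ℕ.* 6
2∣10+6s s = divides (5 ℕ.+ s ℕ.* 3) (cong (10 ℕ.+_) (sym (ℕ.*-assoc s 3 2)))

-- As 2 divides 12 + 6s, it would otherwise divide 1.
2∤13+6s : ∀ s → ¬ 2 ∣ 13 ℕ.+ s ℕ.* 6
2∤13+6s s 2∣n with () ← ∣1⇒≡1 (∣m+n∣m⇒∣n
  (subst (2 ∣_) (ℕ.+-comm 1 (12 ℕ.+ s ℕ.* 6)) 2∣n)
  (divides (6 ℕ.+ s ℕ.* 3) (cong (12 ℕ.+_) (sym (ℕ.*-assoc s 3 2)))))

theorem6p11 : (n : ℕ) (10≤n : 10 ≤ n) → n % 3 ≡ 1 → IsLaplacianLike (L̂ n 10≤n)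
theorem6p11 n 10≤n n%3≡1 with residues-mod-6 10≤n n%3≡1
-- The known divisibility resolves the test in `P`, selecting `z₁` here and `z₂` in the other case.
... | inj₁ (s , refl) = L̂-laplacianLike _ 10≤n (trans
  (cong (λ b → sum (if b then z₁ n else z₂ n)) (dec-true (2 ∣? n) (2∣10+6s s))) (sum-z₁ s))
... | inj₂ (s , refl) = L̂-laplacianLike _ 10≤n (trans
  (cong (λ b → sum (if b then z₁ n else z₂ n)) (dec-false (2 ∣? n) (2∤13+6s s))) (sum-z₂ s))
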